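{- If $G$ and $H$ are simple coherent graphs, then their execution $G::H$ is a simple coherent graph.
   Context: Graphs are directed multigraphs: a vertex set $V(G)$, an edge set $E(G)$, and source and target maps $s,t:E(G)\to V(G)$. A coherence relation is a symmetric reflexive binary relation. A coherent graph is a graph $G$ with a coherence relation on $E(G)$. The vertex sets of two graphs need not be disjoint. Plugging: $G \mathbin{\square} H$ has vertex set $V(G)\cup V(H)$ and edge set $E(G)+E(H)$ (disjoint union, remembering the provenance of edges). Its coherence relation restricts to those of $G$ and $H$, and every edge of $G$ is coherent with every edge of $H$. A path is a sequence $v_0,e_1,v_1,\dots,e_n,v_n$ with $n\ge 1$, $s(e_i)=v_{i-1}$, $t(e_i)=v_i$. A path in $G\mathbin{\square}H$ is alternating if, of any two consecutive edges, exactly one is in $E(G)$. A path is coherent if its edges are pairwise coherent. Two coherent paths are mutually coherent if every edge of one is coherent with every edge of the other. Execution: $G :: H$ has vertex set the symmetric difference $V(G)\mathbin{\triangle}V(H)$, and one edge from $u$ to $v$ for each coherent alternating path from $u$ to $v$ in $G\mathbin{\square}H$ with $u,v\in V(G)\mathbin{\triangle}V(H)$; the coherence of edges is mutual coherence of paths. The simple coherence on $E(G)$ is the relation in which two distinct edges are coherent if and only if they do not have a common vertex (endpoint), every edge being coherent with itself. A coherent graph is simple if its coherence relation is included in the simple coherence, i.e. any two distinct coherent edges have no common endpoint. -}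

module Defs where

open import Data.List using (List; []; _∷_)
open import Data.List.Relation.Binary.Pointwise as Pointwise
  using (Pointwise; []; _∷_)
open import Data.List.Relation.Unary.All as All using (All)
open import Data.List.Relation.Unary.All.Properties using (All-swap)
open import Data.List.Relation.Unary.Linked using (Linked)
open import Data.Product using (∃-syntax; _×_)
open import Data.Sum using (_⊎_; inj₁; inj₂; [_,_])
open import Data.Sum.Relation.Binary.Pointwise using (_⊎ₛ_; inj₁; inj₂)
open import Data.Empty.Polymorphic using (⊥)
open import Data.Unit.Polymorphic using (⊤)
open import Level using (Level; suc)
open import Relation.Binary.Bundles using (Setoid)
open import Relation.Binary.Core using (Rel; _⇒_)
open import Relation.Binary.Definitions
  using (Reflexive; Symmetric; _Respectsʳ_)
open import Relation.Binary.PropositionalEquality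
  using (_≡_; refl)
open import Relation.Nullary using (¬_)
open import Relation.Unary using (Pred; _∈_; _∪_; _∖_)

private variable
  ℓ : Level

infixl 6 _△_
_△_ : {A : Set ℓ} → Pred A ℓ → Pred A ℓ → Pred A ℓ
P △ Q = (P ∖ Q) ∪ (Q ∖ P)

-- Vertices are drawn from an ambient type 𝓥, so that the vertex sets of two
-- graphs may overlap.  The edge set is a setoid because the edges of an
-- execution are paths bundled with proofs of their properties, and two of
-- them are the same edge as soon as the underlying paths agree.

record CoherentGraph (𝓥 : Set ℓ) : Set (suc ℓ) where
  infix 4 _⌣_
  field
    V           : Pred 𝓥 ℓ
    edgeSetoid  : Setoid ℓ ℓ
  open Setoid edgeSetoid public
    renaming (Carrier to E; refl to ≈-refl; sym to ≈-sym; trans to ≈-trans)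
    using (_≈_; _≉_)
  field
    source      : E → 𝓥
    target      : E → 𝓥
    source-cong : ∀ {e f} → e ≈ f → source e ≡ source f
    target-cong : ∀ {e f} → e ≈ f → target e ≡ target f
    source∈V    : ∀ e → source e ∈ V
    target∈V    : ∀ e → target e ∈ V
    _⌣_         : Rel E ℓ
    ⌣-refl      : Reflexive _⌣_
    ⌣-sym       : Symmetric _⌣_
    ⌣-respʳ     : _⌣_ Respectsʳ _≈_

module _ {𝓥 : Set ℓ} (G : CoherentGraph 𝓥) where
  open CoherentGraph G

  IsEndpoint : 𝓥 → E → Set ℓ
  IsEndpoint v e = v ≡ source e ⊎ v ≡ target e

  CommonVertex : Rel E ℓ
  CommonVertex e f = ∃[ v ] IsEndpoint v e × IsEndpoint v f

  -- An implication rather than the disjunction e ≈ f ⊎ ¬ CommonVertex e f,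
  -- since equality of edges is not assumed to be decidable.
  SimpleCoherence : Rel E ℓ
  SimpleCoherence e f = e ≉ f → ¬ CommonVertex e f

  IsSimple : Set ℓ
  IsSimple = _⌣_ ⇒ SimpleCoherence

  data Path (u v : 𝓥) : Set ℓ where
    single : ∀ e → source e ≡ u → target e ≡ v → Path u v
    cons   : ∀ e {w} → source e ≡ u → target e ≡ w → Path w v → Path u v

  edges : ∀ {u v} → Path u v → List E
  edges (single e _ _) = e ∷ []
  edges (cons e _ _ p) = e ∷ edges p

  -- Paths have at least one edge, so their edges determine their vertices.
  infix 4 _≈ₚ_
  _≈ₚ_ : ∀ {u v u′ v′} → Path u v → Path u′ v′ → Set ℓ
  p ≈ₚ q = Pointwise _≈_ (edges p) (edges q)

  MutuallyCoherent : ∀ {u v u′ v′} → Path u v → Path u′ v′ → Set ℓ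
  MutuallyCoherent p q = All (λ e → All (e ⌣_) (edges q)) (edges p)

  IsCoherent : ∀ {u v} → Path u v → Set ℓ
  IsCoherent p = MutuallyCoherent p p

  ≈ₚ⇒source≡ : ∀ {u v u′ v′} (p : Path u v) (q : Path u′ v′) → p ≈ₚ q → u ≡ u′
  ≈ₚ⇒source≡ (single _ refl _) (single _ refl _) (e≈f ∷ _) = source-cong e≈f
  ≈ₚ⇒source≡ (single _ refl _) (cons _ refl _ _) (e≈f ∷ _) = source-cong e≈f
  ≈ₚ⇒source≡ (cons _ refl _ _) (single _ refl _) (e≈f ∷ _) = source-cong e≈f
  ≈ₚ⇒source≡ (cons _ refl _ _) (cons _ refl _ _) (e≈f ∷ _) = source-cong e≈f

  ≈ₚ⇒target≡ : ∀ {u v u′ v′} (p : Path u v) (q : Path u′ v′) → p ≈ₚ q → v ≡ v′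
  ≈ₚ⇒target≡ (single _ _ refl) (single _ _ refl) (e≈f ∷ _) = target-cong e≈f
  ≈ₚ⇒target≡ (single _ _ _) (cons _ _ _ (single _ _ _)) (_ ∷ ())
  ≈ₚ⇒target≡ (single _ _ _) (cons _ _ _ (cons _ _ _ _)) (_ ∷ ())
  ≈ₚ⇒target≡ (cons _ _ _ (single _ _ _)) (single _ _ _) (_ ∷ ())
  ≈ₚ⇒target≡ (cons _ _ _ (cons _ _ _ _)) (single _ _ _) (_ ∷ ())
  ≈ₚ⇒target≡ (cons _ _ _ p) (cons _ _ _ q) (_ ∷ p≈q) = ≈ₚ⇒target≡ p q p≈q

  MutuallyCoherent-sym : ∀ {u v u′ v′} (p : Path u v) (q : Path u′ v′) →
                         MutuallyCoherent p q → MutuallyCoherent q p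
  MutuallyCoherent-sym p q p⌣q =
    All.map (All.map ⌣-sym) (All-swap p⌣q)

  MutuallyCoherent-respʳ :
    ∀ {u v u′ v′ u″ v″} (p : Path u v) (q : Path u′ v′) (r : Path u″ v″) →
    q ≈ₚ r → MutuallyCoherent p q → MutuallyCoherent p r
  MutuallyCoherent-respʳ p q r q≈r =
    All.map (Pointwise.All-resp-Pointwise ⌣-respʳ q≈r)

module _ {𝓥 : Set ℓ} where

  infixl 5 _□_ _∷∷_

  _□_ : CoherentGraph 𝓥 → CoherentGraph 𝓥 → CoherentGraph 𝓥
  G □ H = record
    { V           = G.V ∪ H.V
    ; edgeSetoid  = G.edgeSetoid ⊎ₛ H.edgeSetoid
    ; source      = [ G.source , H.source ]
    ; target      = [ G.target , H.target ]
    ; source-cong = λ { (inj₁ e≈f) → G.source-cong e≈f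
                      ; (inj₂ e≈f) → H.source-cong e≈f }
    ; target-cong = λ { (inj₁ e≈f) → G.target-cong e≈f
                      ; (inj₂ e≈f) → H.target-cong e≈f }
    ; source∈V    = λ { (inj₁ e) → inj₁ (G.source∈V e)
                      ; (inj₂ e) → inj₂ (H.source∈V e) }
    ; target∈V    = λ { (inj₁ e) → inj₁ (G.target∈V e)
                      ; (inj₂ e) → inj₂ (H.target∈V e) }
    ; _⌣_         = _⌣_
    ; ⌣-refl      = λ { {inj₁ _} → G.⌣-refl ; {inj₂ _} → H.⌣-refl }
    ; ⌣-sym       = λ {e} {f} → ⌣-sym e f
    ; ⌣-respʳ     = λ {e} → ⌣-respʳ e
    }
    where
    module G = CoherentGraph G
    module H = CoherentGraph H
    open Setoid (G.edgeSetoid ⊎ₛ H.edgeSetoid) using (_≈_)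

    _⌣_ : Rel (G.E ⊎ H.E) ℓ
    inj₁ e ⌣ inj₁ f = e G.⌣ f
    inj₂ e ⌣ inj₂ f = e H.⌣ f
    inj₁ _ ⌣ inj₂ _ = ⊤
    inj₂ _ ⌣ inj₁ _ = ⊤

    ⌣-sym : ∀ e f → e ⌣ f → f ⌣ e
    ⌣-sym (inj₁ _) (inj₁ _) = G.⌣-sym
    ⌣-sym (inj₁ _) (inj₂ _) = _
    ⌣-sym (inj₂ _) (inj₁ _) = _
    ⌣-sym (inj₂ _) (inj₂ _) = H.⌣-sym

    ⌣-respʳ : ∀ e {f g} → f ≈ g → e ⌣ f → e ⌣ g
    ⌣-respʳ (inj₁ _) (inj₁ f≈g) = G.⌣-respʳ f≈g
    ⌣-respʳ (inj₁ _) (inj₂ _)   = _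
    ⌣-respʳ (inj₂ _) (inj₁ _)   = _
    ⌣-respʳ (inj₂ _) (inj₂ f≈g) = H.⌣-respʳ f≈g

  module _ (G H : CoherentGraph 𝓥) where
    private
      module G = CoherentGraph G
      module H = CoherentGraph H
      module □ = CoherentGraph (G □ H)

    InG : Pred □.E ℓ
    InG (inj₁ _) = ⊤
    InG (inj₂ _) = ⊥

    ExactlyOneInG : Rel □.E ℓ
    ExactlyOneInG e f = (e ∈ InG × ¬ f ∈ InG) ⊎ (¬ e ∈ InG × f ∈ InG)

    IsAlternating : ∀ {u v} → Path (G □ H) u v → Set ℓ
    IsAlternating p = Linked ExactlyOneInG (edges (G □ H) p)

    record ExecutionEdge : Set ℓ where
      field
        {start}     : 𝓥
        {end}       : 𝓥
        path        : Path (G □ H) start end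
        coherent    : IsCoherent (G □ H) path
        alternating : IsAlternating path
        start∈△     : start ∈ G.V △ H.V
        end∈△       : end ∈ G.V △ H.V

  _∷∷_ : CoherentGraph 𝓥 → CoherentGraph 𝓥 → CoherentGraph 𝓥
  G ∷∷ H = record
    { V           = G.V △ H.V
    ; edgeSetoid  = record
      { Carrier       = ExecutionEdge G H
      ; _≈_           = λ a b → _≈ₚ_ (G □ H) (path a) (path b)
      ; isEquivalence = record
        { refl  = Pointwise.refl □.≈-refl
        ; sym   = Pointwise.symmetric □.≈-sym
        ; trans = Pointwise.transitive □.≈-trans
        }
      }
    ; source      = start
    ; target      = end
    ; source-cong = λ {a} {b} → ≈ₚ⇒source≡ (G □ H) (path a) (path b)
    ; target-cong = λ {a} {b} → ≈ₚ⇒target≡ (G □ H) (path a) (path b)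
    ; source∈V    = start∈△
    ; target∈V    = end∈△
    ; _⌣_         = λ a b → MutuallyCoherent (G □ H) (path a) (path b)
    ; ⌣-refl      = λ {a} → coherent a
    ; ⌣-sym       = λ {a} {b} → MutuallyCoherent-sym (G □ H) (path a) (path b)
    ; ⌣-respʳ     = λ {a} {b} {c} →
        MutuallyCoherent-respʳ (G □ H) (path a) (path b) (path c)
    }
    where
    open ExecutionEdge
    module G = CoherentGraph G
    module H = CoherentGraph H
    module □ = CoherentGraph (G □ H)

{-# OPTIONS --safe #-}

-- Two mutually coherent alternating paths that share a boundary vertex u, one
-- in V G △ V H, have their edges at u on the same side, since u lies in only
-- one of the two graphs; simplicity makes them equal.  Their other endpoints
-- then agree, the next edges are again on the same side (alternation), and the
-- equality propagates.  Neither path can stop before the other, because a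
-- vertex between an edge of G and an edge of H belongs to both vertex sets.
-- Edge equality being undecidable, the conclusion is ¬ ¬ (p ≈ₚ q).

module Submission where

open import Defs
open import Data.List using (_∷_)
open import Data.List.Relation.Binary.Pointwise using ([]; _∷_)
open import Data.List.Relation.Unary.All as All using (All; _∷_)
open import Data.List.Relation.Unary.Linked as Linked using (Linked; _∷_)
open import Data.Product using (_,_)
open import Data.Sum using (inj₁; inj₂)
open import Data.Sum.Relation.Binary.Pointwise using (inj₁; inj₂)
open import Level using (Level)
open import Relation.Binary.PropositionalEquality
  using (_≡_; refl; sym; trans; subst)
open import Relation.Nullary using (¬_; contradiction)
open import Relation.Unary using (_∈_)

private variable
  ℓ : Level

module _ {𝓥 : Set ℓ} (K : CoherentGraph 𝓥) where
  open CoherentGraph K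

  first : ∀ {u v} → Path K u v → E
  first (single e _ _) = e
  first (cons e _ _ _) = e

  source-first : ∀ {u v} (p : Path K u v) → source (first p) ≡ u
  source-first (single _ s _) = s
  source-first (cons _ s _ _) = s

  ≈ₚ⇒first≈ : ∀ {u v u′ v′} (p : Path K u v) (q : Path K u′ v′) →
              _≈ₚ_ K p q → first p ≈ first q
  ≈ₚ⇒first≈ (single _ _ _) (single _ _ _) (e≈f ∷ _) = e≈f
  ≈ₚ⇒first≈ (single _ _ _) (cons _ _ _ _) (e≈f ∷ _) = e≈f
  ≈ₚ⇒first≈ (cons _ _ _ _) (single _ _ _) (e≈f ∷ _) = e≈f
  ≈ₚ⇒first≈ (cons _ _ _ _) (cons _ _ _ _) (e≈f ∷ _) = e≈f

module _ {𝓥 : Set ℓ} (G H : CoherentGraph 𝓥) where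
  private
    module G = CoherentGraph G
    module H = CoherentGraph H
    K = G □ H
    Opposite = ExactlyOneInG G H
    Alternating : ∀ {u v} → Path K u v → Set ℓ
    Alternating = IsAlternating G H
  open CoherentGraph K using (E; source; target; _≈_; _⌣_)

  -- Sides of edges and boundary vertices.

  G-endpoint∈V : ∀ {v e} → IsEndpoint G v e → v ∈ G.V
  G-endpoint∈V {e = e} (inj₁ refl) = G.source∈V e
  G-endpoint∈V {e = e} (inj₂ refl) = G.target∈V e

  H-endpoint∈V : ∀ {v e} → IsEndpoint H v e → v ∈ H.V
  H-endpoint∈V {e = e} (inj₁ refl) = H.source∈V e
  H-endpoint∈V {e = e} (inj₂ refl) = H.target∈V e

  V-disjoint-at-△ : ∀ {v} → v ∈ G.V △ H.V → v ∈ G.V → ¬ v ∈ H.V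
  V-disjoint-at-△ (inj₁ (_ , v∉H)) _ v∈H = v∉H v∈H
  V-disjoint-at-△ (inj₂ (_ , v∉G)) v∈G _ = v∉G v∈G

  -- Opposite edges meeting at `v` would put `v` in both vertex sets.
  ¬opposite-at-△ : ∀ {v} e f → v ∈ G.V △ H.V →
                   IsEndpoint K v e → IsEndpoint K v f → ¬ Opposite e f
  ¬opposite-at-△ (inj₁ _) (inj₁ _) _ _ _ (inj₁ (_ , f∉G)) = f∉G _
  ¬opposite-at-△ (inj₁ _) (inj₁ _) _ _ _ (inj₂ (e∉G , _)) = e∉G _
  ¬opposite-at-△ (inj₁ _) (inj₂ _) v∈△ ve vf _ =
    V-disjoint-at-△ v∈△ (G-endpoint∈V ve) (H-endpoint∈V vf)
  ¬opposite-at-△ (inj₂ _) (inj₁ _) v∈△ ve vf _ =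
    V-disjoint-at-△ v∈△ (G-endpoint∈V vf) (H-endpoint∈V ve)
  ¬opposite-at-△ (inj₂ _) (inj₂ _) _ _ _ (inj₁ (() , _))
  ¬opposite-at-△ (inj₂ _) (inj₂ _) _ _ _ (inj₂ (_ , ()))

  opposite-sym : ∀ {e f} → Opposite e f → Opposite f e
  opposite-sym (inj₁ (e∈G , f∉G)) = inj₂ (f∉G , e∈G)
  opposite-sym (inj₂ (e∉G , f∈G)) = inj₁ (f∈G , e∉G)

  InG-resp-≈ : ∀ {e f} → e ≈ f → e ∈ InG G H → f ∈ InG G H
  InG-resp-≈ (inj₁ _) _ = _
  InG-resp-≈ (inj₂ _) ()

  -- There are only two sides and `≈` preserves them, so the neighbours of equal edges both lie on
  -- the remaining side.
  opposites-of-≈ : ∀ {e f e′ f′} → e ≈ f → Opposite e e′ → Opposite f f′ →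
                   ¬ Opposite e′ f′
  opposites-of-≈ e≈f (inj₁ (_ , e′∉G)) _ (inj₁ (e′∈G , _)) = e′∉G e′∈G
  opposites-of-≈ e≈f (inj₁ (e∈G , _)) (inj₁ (_ , f′∉G)) (inj₂ (_ , f′∈G)) =
    f′∉G f′∈G
  opposites-of-≈ e≈f (inj₁ (e∈G , _)) (inj₂ (f∉G , _)) _ =
    f∉G (InG-resp-≈ e≈f e∈G)
  opposites-of-≈ e≈f (inj₂ (e∉G , _)) (inj₁ (f∈G , _)) _ =
    e∉G (InG-resp-≈ (CoherentGraph.≈-sym K e≈f) f∈G)
  opposites-of-≈ e≈f (inj₂ _) (inj₂ (_ , f′∈G)) (inj₁ (_ , f′∉G)) = f′∉G f′∈G
  opposites-of-≈ e≈f (inj₂ (_ , e′∈G)) (inj₂ _) (inj₂ (e′∉G , _)) = e′∉G e′∈G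

  alternating⇒opposite :
    ∀ {e w v} (p : Path K w v) →
    Linked Opposite (e ∷ edges K p) → Opposite e (first K p)
  alternating⇒opposite (single _ _ _) (o ∷ _) = o
  alternating⇒opposite (cons _ _ _ _) (o ∷ _) = o

  -- Two opposite edges meet at `w`. This is what forbids one path to stop where an equal one
  -- continues.
  interior∉△ :
    ∀ {e w v} → target e ≡ w → (p : Path K w v) →
    Linked Opposite (e ∷ edges K p) → ¬ w ∈ G.V △ H.V
  interior∉△ {e} t p alt w∈△ =
    ¬opposite-at-△ e (first K p) w∈△
      (inj₂ (sym t)) (inj₁ (sym (source-first K p)))
      (alternating⇒opposite p alt)

  -- Suffixes of paths.

  infix 4 _suffix-of_
  -- Paths are built from the front, whereas paths with a common target must be compared from the
  -- back. Suffixes up to `≈ₚ` record how far that comparison has come.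
  data _suffix-of_ {u v} (p : Path K u v) : ∀ {u′ v′} → Path K u′ v′ → Set ℓ
    where
    here  : ∀ {u′ v′} {q : Path K u′ v′} → _≈ₚ_ K p q → p suffix-of q
    there : ∀ {u′ w v′ f} {s : source f ≡ u′} {t : target f ≡ w}
              {q : Path K w v′} →
            p suffix-of q → p suffix-of cons f s t q

  -- A proper suffix of `q` would start at an interior vertex of `q`, hence off the boundary.
  suffix-from-△⇒≈ₚ :
    ∀ {u v u′ v′} (p : Path K u v) (q : Path K u′ v′) → u ∈ G.V △ H.V →
    Alternating q → p suffix-of q → _≈ₚ_ K p q
  suffix-from-△⇒≈ₚ p q u∈△ alt (here p≈q) = p≈q
  suffix-from-△⇒≈ₚ p (cons _ _ t q) u∈△ alt (there p⊑q) =
    contradiction (subst (_∈ G.V △ H.V) (≈ₚ⇒source≡ K p q p≈q) u∈△)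
                  (interior∉△ t q alt)
    where p≈q = suffix-from-△⇒≈ₚ p q u∈△ (Linked.tail alt) p⊑q

  -- Comparison of mutually coherent paths.

  module _ (G-simple : IsSimple G) (H-simple : IsSimple H) where

    -- Coherence across the two sides carries no information, so simplicity can be applied only once
    -- both edges are known to lie in the same graph.
    same-side⇒¬¬≈ : ∀ e f → ¬ Opposite e f → e ⌣ f → CommonVertex K e f →
                    ¬ ¬ e ≈ f
    same-side⇒¬¬≈ (inj₁ _) (inj₁ _) _ e⌣f common e≉f =
      G-simple e⌣f (λ e≈f → e≉f (inj₁ e≈f)) common
    same-side⇒¬¬≈ (inj₁ _) (inj₂ _) ¬opp _ _ _ = ¬opp (inj₁ (_ , λ ()))
    same-side⇒¬¬≈ (inj₂ _) (inj₁ _) ¬opp _ _ _ = ¬opp (inj₂ ((λ ()) , _))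
    same-side⇒¬¬≈ (inj₂ _) (inj₂ _) _ e⌣f common e≉f =
      H-simple e⌣f (λ e≈f → e≉f (inj₂ e≈f)) common

    -- Asking that the first edges be on the same side, instead of `u` being on the boundary, lets
    -- the induction pass through interior vertices.
    same-source⇒¬¬≈ₚ :
      ∀ {u v v′} (p : Path K u v) (q : Path K u v′) →
      v ∈ G.V △ H.V → v′ ∈ G.V △ H.V → Alternating p → Alternating q →
      MutuallyCoherent K p q → ¬ Opposite (first K p) (first K q) →
      ¬ ¬ _≈ₚ_ K p q
    same-source⇒¬¬≈ₚ (single e s _) (single f s′ _) _ _ _ _
                     ((e⌣f ∷ _) ∷ _) ¬opp p≉q =
      same-side⇒¬¬≈ e f ¬opp e⌣f (_ , inj₁ (sym s) , inj₁ (sym s′))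
        λ e≈f → p≉q (e≈f ∷ [])
    same-source⇒¬¬≈ₚ (single e s refl) (cons f s′ refl q) v∈△ _ _ alt
                     ((e⌣f ∷ _) ∷ _) ¬opp p≉q =
      same-side⇒¬¬≈ e f ¬opp e⌣f (_ , inj₁ (sym s) , inj₁ (sym s′))
        -- The boundary vertex `v` would be the target of `f`, from which `q` continues.
        λ e≈f → interior∉△ refl q alt
          (subst (_∈ G.V △ H.V) (CoherentGraph.target-cong K e≈f) v∈△)
    same-source⇒¬¬≈ₚ (cons e s refl p) (single f s′ refl) _ v′∈△ alt _
                     ((e⌣f ∷ _) ∷ _) ¬opp p≉q =
      same-side⇒¬¬≈ e f ¬opp e⌣f (_ , inj₁ (sym s) , inj₁ (sym s′))
        λ e≈f → interior∉△ refl p alt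
          (subst (_∈ G.V △ H.V) (sym (CoherentGraph.target-cong K e≈f)) v′∈△)
    same-source⇒¬¬≈ₚ (cons e s t p) (cons f s′ t′ q) v∈△ v′∈△ alt alt′
                     ((e⌣f ∷ _) ∷ p⌣fq) ¬opp p≉q =
      same-side⇒¬¬≈ e f ¬opp e⌣f (_ , inj₁ (sym s) , inj₁ (sym s′))
        λ e≈f → tails e≈f
          (trans (sym t) (trans (CoherentGraph.target-cong K e≈f) t′))
      where
      -- As `t` and `t′` are not matched, the two second vertices are still variables, and `refl`
      -- can identify them.
      tails : e ≈ f → _ ≡ _ → _
      tails e≈f refl =
        same-source⇒¬¬≈ₚ p q v∈△ v′∈△ (Linked.tail alt) (Linked.tail alt′)
          (All.map All.tail p⌣fq)
          (opposites-of-≈ e≈f (alternating⇒opposite p alt)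
                              (alternating⇒opposite q alt′))
          λ p≈q → p≉q (e≈f ∷ p≈q)

    -- The last edge of `q` touches the boundary vertex `v`, so it is on the side of `e`. Allowing
    -- either endpoint of `e` to be `v` also covers a path that starts where `q` ends.
    last-edge : ∀ {u v u′ v′} e {s : source e ≡ u′} {t : target e ≡ v′}
                (q : Path K u v) → v ∈ G.V △ H.V →
                IsEndpoint K v e → All (e ⌣_) (edges K q) →
                ¬ ¬ single e s t suffix-of q
    last-edge e (single f _ t) v∈△ ve (e⌣f ∷ _) e⋢q =
      same-side⇒¬¬≈ e f (¬opposite-at-△ e f v∈△ ve (inj₂ (sym t))) e⌣f
        (_ , ve , inj₂ (sym t)) λ e≈f → e⋢q (here (e≈f ∷ []))
    last-edge e (cons f _ _ q) v∈△ ve (_ ∷ e⌣q) e⋢q =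
      last-edge e q v∈△ ve e⌣q λ e⊑q → e⋢q (there e⊑q)

    -- Where `p` matches all of `q`, the edges `e` and `f` precede equal first edges: they are on
    -- the same side and end at the same vertex. A deeper match is reached by dropping edges of `q`.
    extend-suffix :
      ∀ {u v w u′ v′ w′ e f}
        {s : source e ≡ u} {t : target e ≡ w}
        {s′ : source f ≡ u′} {t′ : target f ≡ w′}
        (p : Path K w v) (q : Path K w′ v′) →
      Alternating (cons e s t p) → Alternating (cons f s′ t′ q) →
      All (e ⌣_) (f ∷ edges K q) → p suffix-of q →
      ¬ ¬ cons e s t p suffix-of cons f s′ t′ q
    extend-suffix {e = e} {f = f} {t = t} {t′ = t′} p q alt alt′ (e⌣f ∷ _)
                  (here p≈q) ep⋢fq =
      same-side⇒¬¬≈ e f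
        (opposites-of-≈ (≈ₚ⇒first≈ K p q p≈q)
          (opposite-sym {e} (alternating⇒opposite p alt))
          (opposite-sym {f} (alternating⇒opposite q alt′)))
        e⌣f
        (_ , inj₂ (sym t) , inj₂ (trans (≈ₚ⇒source≡ K p q p≈q) (sym t′)))
        λ e≈f → ep⋢fq (here (e≈f ∷ p≈q))
    extend-suffix p (cons _ _ _ q) alt alt′ (_ ∷ e⌣q) (there p⊑q) ep⋢fq =
      extend-suffix p q alt (Linked.tail alt′) e⌣q p⊑q
        λ ep⊑q → ep⋢fq (there ep⊑q)

    same-target⇒¬¬suffix :
      ∀ {u u′ v} (p : Path K u v) (q : Path K u′ v) →
      u′ ∈ G.V △ H.V → v ∈ G.V △ H.V → Alternating p → Alternating q →
      MutuallyCoherent K p q → ¬ ¬ p suffix-of q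
    same-target⇒¬¬suffix (single e _ t) q _ v∈△ _ _ (e⌣q ∷ _) =
      last-edge e q v∈△ (inj₂ (sym t)) e⌣q
    same-target⇒¬¬suffix (cons e s t p) q u′∈△ v∈△ alt alt′ (e⌣q ∷ p⌣q) ep⋢q =
      same-target⇒¬¬suffix p q u′∈△ v∈△ (Linked.tail alt) alt′ p⌣q
        (grow q u′∈△ alt′ e⌣q ep⋢q)
      where
      -- `p` starts at an interior vertex of the longer path, so it cannot match all of `q`, which
      -- starts on the boundary. Some edge of `q` is therefore left to be compared with `e`.
      grow : ∀ {u′ v′} (q : Path K u′ v′) → u′ ∈ G.V △ H.V → Alternating q →
             All (e ⌣_) (edges K q) → ¬ cons e s t p suffix-of q →
             ¬ p suffix-of q
      grow q u′∈△ _ _ _ (here p≈q) =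
        interior∉△ t p alt
          (subst (_∈ G.V △ H.V) (sym (≈ₚ⇒source≡ K p q p≈q)) u′∈△)
      grow (cons _ _ _ q) _ alt′ e⌣q ep⋢q (there p⊑q) =
        extend-suffix p q alt alt′ e⌣q p⊑q ep⋢q

    same-target⇒¬¬≈ₚ :
      ∀ {u u′ v} (p : Path K u v) (q : Path K u′ v) →
      u ∈ G.V △ H.V → u′ ∈ G.V △ H.V → v ∈ G.V △ H.V →
      Alternating p → Alternating q →
      MutuallyCoherent K p q → ¬ ¬ _≈ₚ_ K p q
    same-target⇒¬¬≈ₚ p q u∈△ u′∈△ v∈△ alt alt′ p⌣q p≉q =
      same-target⇒¬¬suffix p q u′∈△ v∈△ alt alt′ p⌣q
        λ p⊑q → p≉q (suffix-from-△⇒≈ₚ p q u∈△ alt′ p⊑q)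

    -- The first edge of p is then the last edge of q, hence a loop on the
    -- boundary, so that neither path has any other edge.
    source≡target⇒¬¬≈ₚ :
      ∀ {u v w} (p : Path K u v) (q : Path K w u) →
      u ∈ G.V △ H.V → Alternating p → Alternating q →
      MutuallyCoherent K p q → ¬ ¬ _≈ₚ_ K p q
    source≡target⇒¬¬≈ₚ (single e refl t) q u∈△ _ alt′ (e⌣q ∷ _) p≉q =
      last-edge e q u∈△ (inj₁ refl) e⌣q
        λ e⊑q → p≉q (suffix-from-△⇒≈ₚ (single e refl t) q u∈△ alt′ e⊑q)
    source≡target⇒¬¬≈ₚ (cons e refl t p) q u∈△ alt alt′ (e⌣q ∷ _) _ =
      last-edge e q u∈△ (inj₁ refl) e⌣q
        λ e⊑q → interior∉△ t p alt
          (subst (_∈ G.V △ H.V)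
            (sym (≈ₚ⇒target≡ K ē q (suffix-from-△⇒≈ₚ ē q u∈△ alt′ e⊑q))) u∈△)
      where ē = single e refl t

proposition25 : ∀ {ℓ : Level} {𝓥 : Set ℓ} (G H : CoherentGraph 𝓥) →
    IsSimple G → IsSimple H → IsSimple (G ∷∷ H)
proposition25 G H G-simple H-simple {a} {b} a⌣b a≉b = λ where
    (_ , inj₁ refl , inj₁ refl) →
      same-source⇒¬¬≈ₚ G H G-simple H-simple a.path b.path
        a.end∈△ b.end∈△ a.alternating b.alternating a⌣b
        (¬opposite-at-△ G H (first K a.path) (first K b.path) a.start∈△
          (inj₁ (sym (source-first K a.path)))
          (inj₁ (sym (source-first K b.path))))
        a≉b
    (_ , inj₁ refl , inj₂ refl) →
      source≡target⇒¬¬≈ₚ G H G-simple H-simple a.path b.path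
        a.start∈△ a.alternating b.alternating a⌣b a≉b
    (_ , inj₂ refl , inj₁ refl) →
      source≡target⇒¬¬≈ₚ G H G-simple H-simple b.path a.path
        b.start∈△ b.alternating a.alternating
        (MutuallyCoherent-sym K a.path b.path a⌣b)
        λ b≈a → a≉b (CoherentGraph.≈-sym (G ∷∷ H) {b} {a} b≈a)
    (_ , inj₂ refl , inj₂ refl) →
      same-target⇒¬¬≈ₚ G H G-simple H-simple a.path b.path
        a.start∈△ b.start∈△ a.end∈△ a.alternating b.alternating a⌣b a≉b
  where
  K = G □ H
  module a = ExecutionEdge a
  module b = ExecutionEdge b
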